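{- Let $G$ be a $2$-connected graph, and let $L(G)$ denote its line graph. Then (1) $\omega_3(G)\leq \pi_3(L(G))$; (2) $\omega_3(L(G))\geq \omega_3(G)-1$; (3) $\pi_3(L(L(G)))\geq \pi_3(G)-1$.
   Context: All graphs are finite, simple and undirected. For a graph $G$ and a set $S\subseteq V(G)$ with $|S|\geq 2$, an $S$-path is a subgraph $P$ of $G$ that is a path with $S\subseteq V(P)$. Two $S$-paths $P,P'$ are internally disjoint if $E(P)\cap E(P')=\varnothing$ and $V(P)\cap V(P')=S$; they are edge-disjoint if $E(P)\cap E(P')=\varnothing$. $\pi_G(S)$ is the maximum number of pairwise internally disjoint $S$-paths in $G$, and $\omega_G(S)$ is the maximum number of pairwise edge-disjoint $S$-paths in $G$. For an integer $k$ with $2\leq k\leq |V(G)|$, $\pi_k(G)=\min\{\pi_G(S): S\subseteq V(G), |S|=k\}$ (path $k$-connectivity) and $\omega_k(G)=\min\{\omega_G(S): S\subseteq V(G), |S|=k\}$ (path $k$-edge-connectivity). -}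

module Defs where

open import Data.Nat using (ℕ; zero; suc; _≤_; _<ᵇ_; _≡ᵇ_; _∸_)
open import Data.Bool using (Bool; true; false; T; _∧_; _∨_; not; if_then_else_)
open import Data.Fin using (Fin; toℕ; punchIn)
open import Data.Fin.Subset using (Subset; ∣_∣) renaming (_∈_ to _∈ₛ_)
open import Data.List using (List; []; _∷_; [_]; concatMap; allFin; length; lookup)
open import Data.List.Membership.Propositional using () renaming (_∈_ to _∈ₗ_)
open import Data.List.Relation.Unary.Unique.Propositional using (Unique)
open import Data.List.Relation.Unary.Linked using (Linked)
open import Data.Product using (Σ; ∃; _×_; _,_)
open import Data.Sum using (_⊎_)
open import Relation.Nullary using (¬_)
open import Relation.Binary.PropositionalEquality using (_≡_; _≢_)

record Graph : Set where
  constructor mkGraph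
  field
    n   : ℕ
    adj : Fin n → Fin n → Bool

open Graph public

Adj : (G : Graph) → Fin (n G) → Fin (n G) → Set
Adj G u v = T (adj G u v)

IsSimple : Graph → Set
IsSimple G = (∀ u v → adj G u v ≡ adj G v u) × (∀ v → adj G v v ≡ false)

data Walk (G : Graph) : Fin (n G) → Fin (n G) → Set where
  here : ∀ {u} → Walk G u u
  step : ∀ {u v w} → Adj G u v → Walk G v w → Walk G u w

Connected : Graph → Set
Connected G = ∀ u v → Walk G u v

delete′ : ∀ {m} → (Fin m → Fin m → Bool) → Fin m → Graph
delete′ {suc m} a x = mkGraph m (λ i j → a (punchIn x i) (punchIn x j))

delete : (G : Graph) → Fin (n G) → Graph
delete G x = delete′ (adj G) x

TwoConnected : Graph → Set
TwoConnected G = (3 ≤ n G) × Connected G × (∀ x → Connected (delete G x))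

_==_ : ∀ {m} → Fin m → Fin m → Bool
a == b = toℕ a ≡ᵇ toℕ b

edgeList : (G : Graph) → List (Fin (n G) × Fin (n G))
edgeList G =
  concatMap (λ i → concatMap (λ j →
     if (toℕ i <ᵇ toℕ j) ∧ adj G i j then [ (i , j) ] else [])
     (allFin (n G))) (allFin (n G))

shareEnd : ∀ {m} → Fin m × Fin m → Fin m × Fin m → Bool
shareEnd (a , b) (c , d) = (a == c) ∨ (a == d) ∨ (b == c) ∨ (b == d)

L : Graph → Graph
L G = mkGraph (length (edgeList G))
  (λ k l → not (k == l) ∧ shareEnd (lookup (edgeList G) k) (lookup (edgeList G) l))

record Path (G : Graph) : Set where
  constructor mkPath
  field
    verts  : List (Fin (n G))
    unique : Unique verts
    linked : Linked (Adj G) verts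

open Path public

consecPairs : ∀ {A : Set} → List A → List (A × A)
consecPairs []               = []
consecPairs (x ∷ [])         = []
consecPairs (x ∷ y ∷ xs)     = (x , y) ∷ consecPairs (y ∷ xs)

SameEdge : ∀ {A : Set} → A × A → A × A → Set
SameEdge (a , b) (c , d) = (a ≡ c × b ≡ d) ⊎ (a ≡ d × b ≡ c)

EdgeDisjoint : ∀ {G} → Path G → Path G → Set
EdgeDisjoint P Q = ∀ e e′ → e ∈ₗ consecPairs (verts P) → e′ ∈ₗ consecPairs (verts Q)
                   → ¬ SameEdge e e′

IsSPath : ∀ {G} → Subset (n G) → Path G → Set
IsSPath S P = ∀ v → v ∈ₛ S → v ∈ₗ verts P

-- internally disjoint S-paths: edge-disjoint and V(P) ∩ V(Q) = S
-- (S ⊆ V(P) ∩ V(Q) holds since both are S-paths)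
InternallyDisjoint : ∀ {G} → Subset (n G) → Path G → Path G → Set
InternallyDisjoint S P Q =
  EdgeDisjoint P Q × (∀ v → v ∈ₗ verts P → v ∈ₗ verts Q → v ∈ₛ S)

PairwiseSPaths : ∀ {G} → Subset (n G) → (Path G → Path G → Set) → ℕ → Set
PairwiseSPaths {G} S R m =
  Σ (Fin m → Path G) λ ps →
    (∀ i → IsSPath S (ps i)) × (∀ i j → i ≢ j → R (ps i) (ps j))

-- Lower bounds on π_G(S), ω_G(S), π_k(G), ω_k(G):
--   m ≤ π_G(S)  iff there are m pairwise internally disjoint S-paths
--   m ≤ π_k(G)  iff m ≤ π_G(S) for every S ⊆ V(G) with |S| = k
-- (and similarly for ω with edge-disjointness).

πAtLeast : (G : Graph) → Subset (n G) → ℕ → Set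
πAtLeast G S m = PairwiseSPaths {G} S (InternallyDisjoint S) m

ωAtLeast : (G : Graph) → Subset (n G) → ℕ → Set
ωAtLeast G S m = PairwiseSPaths {G} S EdgeDisjoint m

πₖAtLeast : ℕ → Graph → ℕ → Set
πₖAtLeast k G m = ∀ (S : Subset (n G)) → ∣ S ∣ ≡ k → πAtLeast G S m

ωₖAtLeast : ℕ → Graph → ℕ → Set
ωₖAtLeast k G m = ∀ (S : Subset (n G)) → ∣ S ∣ ≡ k → ωAtLeast G S m

{-# OPTIONS --safe #-}
module Submission where

-- Choose distinct ends wᵢ of three edges kᵢ of G. An {w₁,w₂,w₃}-path of G, trimmed to run from one
-- wᵢ via the second to the third and read as its sequence of edges with the kᵢ inserted, is a
-- {k₁,k₂,k₃}-path of L(G), and edge-disjoint paths of G give paths of L(G) that meet only in the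
-- kᵢ. If two of the latter shared an edge kᵢkⱼ, both paths of G would run from wᵢ to wⱼ through kᵢ
-- and kⱼ only, hence one along kᵢ alone and the other along kⱼ alone, making kᵢ and kⱼ parallel.
-- So ω₃(G) ≤ π₃(L(G)) for every simple G, and with π₃ ≤ ω₃ this gives π₃(G) ≤ ω₃(G) ≤ π₃(L(G))
-- ≤ ω₃(L(G)) ≤ π₃(L(L(G))), from which the three inequalities follow.

open import Defs
open import Data.Nat using (ℕ; zero; suc; _∸_; _<_; _<ᵇ_; _≡ᵇ_)
import Data.Nat.Properties as ℕ
open import Data.Bool using (true; false; T; _∧_; _∨_; not; if_then_else_)
open import Data.Bool.Properties using (T-∧; T-∨)
open import Data.Empty using (⊥; ⊥-elim)
open import Data.Fin using (Fin; zero; suc; toℕ; inject≤)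
open import Data.Fin.Properties using (_≟_; all?; toℕ-injective; suc-injective; inject≤-injective)
open import Data.Fin.Subset using (Subset; ∣_∣; ⁅_⁆; _∪_; inside; outside)
  renaming (_∈_ to _∈ₛ_; _∉_ to _∉ₛ_)
open import Data.Fin.Subset.Properties using (∪-identityˡ; ∣⁅x⁆∣≡1; x∈⁅x⁆; x∈⁅y⁆⇒x≡y; x∈p∪q⁺; x∈p∪q⁻)
open import Data.List using (List; []; _∷_; [_]; _++_; concatMap; allFin; lookup)
open import Data.List.Properties using (++-assoc)
open import Data.List.Membership.Propositional using (_∈_; _∉_; find; lose)
open import Data.List.Membership.Propositional.Properties
  using (∈-++⁺ˡ; ∈-++⁺ʳ; ∈-++⁻; ∈-∃++; ∈-concatMap⁺; ∈-concatMap⁻; ∈-allFin; ∈-lookup)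
open import Data.List.Relation.Unary.All as All using (All)
open import Data.List.Relation.Unary.All.Properties using (¬Any⇒All¬)
open import Data.List.Relation.Unary.AllPairs using ([]; _∷_)
open import Data.List.Relation.Unary.Any using (here; there; index)
open import Data.List.Relation.Unary.Any.Properties using (lookup-index)
open import Data.List.Relation.Unary.Linked using (Linked; []; [-]; _∷_)
import Data.List.Relation.Unary.Linked as Linked
open import Data.List.Relation.Unary.Unique.Propositional using (Unique)
open import Data.List.Relation.Unary.Unique.Propositional.Properties
  using (++⁺; allFin⁺; Unique[x∷xs]⇒x∉xs)
open import Data.Product using (Σ; ∃; ∃₂; _×_; _,_; proj₁; proj₂)
open import Data.Sum using (_⊎_; inj₁; inj₂; [_,_]′)
open import Data.Vec using (_∷_; []; here; there)
open import Function using (_∘_; case_of_)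
open import Function.Bundles using (Equivalence)
open import Relation.Binary.Definitions using (tri<; tri≈; tri>)
open import Relation.Nullary using (Dec; ¬_; yes; no; contradiction)
open import Relation.Nullary.Decidable using (_×-dec_; _⊎-dec_; _→-dec_; ¬?; from-yes)
open import Relation.Binary.PropositionalEquality
  using (_≡_; _≢_; refl; sym; trans; cong; cong₂; subst; ≢-sym)

-- Lists: uniqueness, linkedness and concatenation.

private
  variable
    A B : Set
    x y z : A
    xs ys zs : List A

unique-∷ : x ∉ xs → Unique xs → Unique (x ∷ xs)
unique-∷ x∉xs u = ¬Any⇒All¬ _ x∉xs ∷ u

unique-++⁻ˡ : ∀ (xs : List A) → Unique (xs ++ ys) → Unique xs
unique-++⁻ˡ []       u = []
unique-++⁻ˡ (x ∷ xs) u@(_ ∷ u′) =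
  unique-∷ (Unique[x∷xs]⇒x∉xs u ∘ ∈-++⁺ˡ) (unique-++⁻ˡ xs u′)

unique-++⁻ʳ : ∀ (xs : List A) → Unique (xs ++ ys) → Unique ys
unique-++⁻ʳ []       u       = u
unique-++⁻ʳ (x ∷ xs) (_ ∷ u) = unique-++⁻ʳ xs u

unique-++-disjoint : ∀ (xs : List A) → Unique (xs ++ ys) → z ∈ xs → z ∉ ys
unique-++-disjoint (x ∷ xs) u       (here refl)  z∈ys = Unique[x∷xs]⇒x∉xs u (∈-++⁺ʳ xs z∈ys)
unique-++-disjoint (x ∷ xs) (_ ∷ u) (there z∈xs) z∈ys = unique-++-disjoint xs u z∈xs z∈ys

unique-lookup-injective : Unique xs → ∀ i j → lookup xs i ≡ lookup xs j → i ≡ j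
unique-lookup-injective {xs = _ ∷ _} u       zero    zero    eq = refl
unique-lookup-injective {xs = _ ∷ _} u       zero    (suc j) eq =
  contradiction (subst (_∈ _) (sym eq) (∈-lookup j)) (Unique[x∷xs]⇒x∉xs u)
unique-lookup-injective {xs = _ ∷ _} u       (suc i) zero    eq =
  contradiction (subst (_∈ _) eq (∈-lookup i)) (Unique[x∷xs]⇒x∉xs u)
unique-lookup-injective {xs = _ ∷ _} (_ ∷ u) (suc i) (suc j) eq = cong suc (unique-lookup-injective u i j eq)

unique-concatMap : ∀ (f : A → List B) → (∀ x → Unique (f x)) →
                   (∀ {x y z} → z ∈ f x → z ∈ f y → x ≡ y) →
                   Unique xs → Unique (concatMap f xs)
unique-concatMap f u inj [] = []
unique-concatMap f u inj (x∉ ∷ uxs) = ++⁺ (u _) (unique-concatMap f u inj uxs)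
  λ (z∈fx , z∈rest) → case find (∈-concatMap⁻ f z∈rest) of
    λ (y , y∈xs , z∈fy) → Unique[x∷xs]⇒x∉xs (x∉ ∷ uxs) (subst (_∈ _) (sym (inj z∈fx z∈fy)) y∈xs)

module _ {R : A → A → Set} where

  linked-++⁻ˡ : ∀ xs → Linked R (xs ++ ys) → Linked R xs
  linked-++⁻ˡ []           l       = []
  linked-++⁻ˡ (x ∷ [])     l       = [-]
  linked-++⁻ˡ (x ∷ y ∷ xs) (r ∷ l) = r ∷ linked-++⁻ˡ (y ∷ xs) l

  linked-++⁻ʳ : ∀ xs → Linked R (xs ++ ys) → Linked R ys
  linked-++⁻ʳ []       l = l
  linked-++⁻ʳ (x ∷ xs) l = linked-++⁻ʳ xs (Linked.tail l)

  linked-glue : ∀ xs → Linked R (xs ++ [ y ]) → Linked R (y ∷ ys) → Linked R (xs ++ y ∷ ys)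
  linked-glue []            _       m = m
  linked-glue (x ∷ [])      (r ∷ _) m = r ∷ m
  linked-glue (x ∷ x′ ∷ xs) (r ∷ l) m = r ∷ linked-glue (x′ ∷ xs) l m

-- Consecutive pairs of a list.

consec-++⁺ˡ : ∀ {e : A × A} xs → e ∈ consecPairs xs → e ∈ consecPairs (xs ++ ys)
consec-++⁺ˡ (x ∷ y ∷ xs) (here eq) = here eq
consec-++⁺ˡ (x ∷ y ∷ xs) (there m) = there (consec-++⁺ˡ (y ∷ xs) m)

consec-∷ : ∀ {e : A × A} xs → e ∈ consecPairs xs → e ∈ consecPairs (x ∷ xs)
consec-∷ (y ∷ xs) m = there m

consec-++⁺ʳ : ∀ {e : A × A} xs → e ∈ consecPairs ys → e ∈ consecPairs (xs ++ ys)
consec-++⁺ʳ []       m = m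
consec-++⁺ʳ (x ∷ xs) m = consec-∷ (xs ++ _) (consec-++⁺ʳ xs m)

consec-++⁻ : ∀ {e : A × A} xs → e ∈ consecPairs (xs ++ y ∷ ys) →
             e ∈ consecPairs (xs ++ [ y ]) ⊎ e ∈ consecPairs (y ∷ ys)
consec-++⁻ []            m         = inj₂ m
consec-++⁻ (x ∷ [])      (here eq) = inj₁ (here eq)
consec-++⁻ (x ∷ [])      (there m) = inj₂ m
consec-++⁻ (x ∷ x′ ∷ xs) (here eq) = inj₁ (here eq)
consec-++⁻ (x ∷ x′ ∷ xs) (there m) with consec-++⁻ (x′ ∷ xs) m
... | inj₁ m′ = inj₁ (there m′)
... | inj₂ m′ = inj₂ m′

consec⇒∈₁ : ∀ xs → (x , y) ∈ consecPairs xs → x ∈ xs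
consec⇒∈₁ (x ∷ y ∷ xs) (here refl) = here refl
consec⇒∈₁ (x ∷ y ∷ xs) (there m)   = there (consec⇒∈₁ (y ∷ xs) m)

consec⇒∈₂ : ∀ xs → (x , y) ∈ consecPairs xs → y ∈ xs
consec⇒∈₂ (x ∷ y ∷ xs) (here refl) = there (here refl)
consec⇒∈₂ (x ∷ y ∷ xs) (there m)   = there (consec⇒∈₂ (y ∷ xs) m)

consec-init : ∀ xs → (x , y) ∈ consecPairs (xs ++ [ z ]) → x ∈ xs
consec-init (x ∷ [])     (here refl) = here refl
consec-init (x ∷ y ∷ xs) (here refl) = here refl
consec-init (x ∷ y ∷ xs) (there m)   = there (consec-init (y ∷ xs) m)

-- Applied to the edge sequence of one segment of a lifted path, whose inner part `is` avoids every
-- `k i`: two of the `k i` can then be consecutive only when `is` is empty.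
consec-ends : ∀ {s t : A} is → (x , y) ∈ consecPairs (s ∷ is ++ [ t ]) →
              (x ∈ is ⊎ y ∈ is) ⊎ (is ≡ [] × x ≡ s × y ≡ t)
consec-ends []       (here refl) = inj₂ (refl , refl , refl)
consec-ends (i ∷ is) (here refl) = inj₁ (inj₂ (here refl))
consec-ends (i ∷ is) (there m)   = inj₁ (inj₁ (consec-init (i ∷ is) m))

-- The order in which a list meets three given points.

Distinct₃ : Fin 3 → Fin 3 → Fin 3 → Set
Distinct₃ a b c = a ≢ b × b ≢ c × a ≢ c

-- Decided by running through all triples of indices.
distinct₃-covers : ∀ a b c → Distinct₃ a b c → ∀ i → i ≡ a ⊎ i ≡ b ⊎ i ≡ c
distinct₃-covers = from-yes covers?
  where
  covers? : Dec (∀ a b c → Distinct₃ a b c → ∀ i → i ≡ a ⊎ i ≡ b ⊎ i ≡ c)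
  covers? = all? λ a → all? λ b → all? λ c →
    (¬? (a ≟ b) ×-dec ¬? (b ≟ c) ×-dec ¬? (a ≟ c)) →-dec
    all? λ i → (i ≟ a) ⊎-dec (i ≟ b) ⊎-dec (i ≟ c)

-- `a`, `b`, `c` is the order in which the list meets the three points; `p` and `s` are the outer
-- parts that `liftPath` trims away.
record Ordered₃ (w : Fin 3 → A) (xs : List A) : Set where
  field
    a b c    : Fin 3
    distinct : Distinct₃ a b c
    p q r s  : List A
    split    : xs ≡ p ++ w a ∷ q ++ w b ∷ r ++ w c ∷ s

order₂ : ∀ {x y : A} → x ≢ y → x ∈ xs → y ∈ xs →
         (∃₂ λ p q → ∃ λ r → xs ≡ p ++ x ∷ q ++ y ∷ r) ⊎
         (∃₂ λ p q → ∃ λ r → xs ≡ p ++ y ∷ q ++ x ∷ r)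
order₂ x≢y x∈xs y∈xs with ∈-∃++ x∈xs
... | p , r , refl with ∈-++⁻ p y∈xs
...   | inj₂ (here refl) = contradiction refl x≢y
...   | inj₂ (there y∈r) with q , r′ , refl ← ∈-∃++ y∈r = inj₁ (p , q , r′ , refl)
...   | inj₁ y∈p with p′ , q , refl ← ∈-∃++ y∈p =
  inj₂ (p′ , q , r , ++-assoc p′ (_ ∷ q) _)

-- Two of the points are ordered by `order₂`; the third then lies in one of the three gaps that they
-- leave.
order₃ : ∀ {w : Fin 3 → A} → (∀ {i j} → w i ≡ w j → i ≡ j) → (∀ i → w i ∈ xs) → Ordered₃ w xs
order₃ {A = A} {xs = xs} {w} w-inj w∈ = case order₂ (w≢ λ ()) (w∈ zero) (w∈ (suc zero)) of λ where
    (inj₁ (p , q , r , eq)) → insert (suc (suc zero)) p q r eq ((λ ()) , (λ ()) , (λ ()))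
    (inj₂ (p , q , r , eq)) → insert (suc (suc zero)) p q r eq ((λ ()) , (λ ()) , (λ ()))
  where
  w≢ : ∀ {i j} → i ≢ j → w i ≢ w j
  w≢ i≢j = i≢j ∘ w-inj

  insert : ∀ {a b} c p q r → xs ≡ p ++ w a ∷ q ++ w b ∷ r → Distinct₃ a b c → Ordered₃ w xs
  insert {a} {b} c p q r refl (a≢b , b≢c , a≢c) with ∈-++⁻ p (w∈ c)
  ... | inj₁ c∈p with p₁ , p₂ , refl ← ∈-∃++ c∈p = record
    { distinct = ≢-sym a≢c , a≢b , ≢-sym b≢c ; split = ++-assoc p₁ (_ ∷ p₂) _ }
  ... | inj₂ (here eq) = contradiction (sym (w-inj eq)) a≢c
  ... | inj₂ (there c∈) with ∈-++⁻ q c∈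
  ...   | inj₁ c∈q with q₁ , q₂ , refl ← ∈-∃++ c∈q = record
    { distinct = a≢c , ≢-sym b≢c , a≢b ; p = p
    ; split = cong (λ t → p ++ w a ∷ t) (++-assoc q₁ (_ ∷ q₂) _) }
  ...   | inj₂ (here eq) = contradiction (sym (w-inj eq)) b≢c
  ...   | inj₂ (there c∈r) with r₁ , r₂ , refl ← ∈-∃++ c∈r = record
    { distinct = a≢b , b≢c , a≢c ; p = p ; q = q ; split = refl }

-- Finite subsets and triples of elements.

enumerate : ∀ {n} (S : Subset n) → Σ (Fin ∣ S ∣ → Fin n) λ k →
            (∀ {i j} → k i ≡ k j → i ≡ j) × (∀ i → k i ∈ₛ S) × (∀ v → v ∈ₛ S → ∃ λ i → v ≡ k i)
enumerate [] = (λ ()) , (λ { {()} }) , (λ ()) , λ ()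
enumerate (outside ∷ S) with k , inj , k∈ , onto ← enumerate S =
  suc ∘ k , inj ∘ suc-injective , there ∘ k∈ ,
  λ { (suc v) (there v∈) → case onto v v∈ of λ (i , eq) → i , cong suc eq }
enumerate {suc n} (inside ∷ S) with k , inj , k∈ , onto ← enumerate S =
  k′ , inj′ , (λ { zero → here ; (suc i) → there (k∈ i) }) ,
  λ { zero _ → zero , refl
    ; (suc v) (there v∈) → case onto v v∈ of λ (i , eq) → suc i , cong suc eq }
  where
  k′ : Fin (suc ∣ S ∣) → Fin (suc n)
  k′ zero    = zero
  k′ (suc i) = suc (k i)
  inj′ : ∀ {i j} → k′ i ≡ k′ j → i ≡ j
  inj′ {zero}  {zero}  _  = refl
  inj′ {suc i} {suc j} eq = cong suc (inj (suc-injective eq))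

∣⁅x⁆∪p∣ : ∀ {n} (x : Fin n) p → x ∉ₛ p → ∣ ⁅ x ⁆ ∪ p ∣ ≡ suc ∣ p ∣
∣⁅x⁆∪p∣ zero    (inside  ∷ p) x∉p = contradiction here x∉p
∣⁅x⁆∪p∣ zero    (outside ∷ p) x∉p = cong (suc ∘ ∣_∣) (∪-identityˡ p)
∣⁅x⁆∪p∣ (suc x) (inside  ∷ p) x∉p = cong suc (∣⁅x⁆∪p∣ x p (x∉p ∘ there))
∣⁅x⁆∪p∣ (suc x) (outside ∷ p) x∉p = ∣⁅x⁆∪p∣ x p (x∉p ∘ there)

triple : ∀ {n} (w : Fin 3 → Fin n) → (∀ {i j} → w i ≡ w j → i ≡ j) →
         Σ (Subset n) λ S → ∣ S ∣ ≡ 3 × (∀ i → w i ∈ₛ S)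
triple w w-inj = ⁅ w₀ ⁆ ∪ (⁅ w₁ ⁆ ∪ ⁅ w₂ ⁆) , size ,
  λ { zero             → x∈p∪q⁺ (inj₁ (x∈⁅x⁆ w₀))
    ; (suc zero)       → x∈p∪q⁺ (inj₂ (x∈p∪q⁺ (inj₁ (x∈⁅x⁆ w₁))))
    ; (suc (suc zero)) → x∈p∪q⁺ (inj₂ (x∈p∪q⁺ {p = ⁅ w₁ ⁆} (inj₂ (x∈⁅x⁆ w₂)))) }
  where
  w₀ = w zero
  w₁ = w (suc zero)
  w₂ = w (suc (suc zero))
  ∉⁅⁆ : ∀ i j → i ≢ j → w i ∉ₛ ⁅ w j ⁆
  ∉⁅⁆ _ _ i≢j = i≢j ∘ w-inj ∘ x∈⁅y⁆⇒x≡y _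
  size : ∣ ⁅ w₀ ⁆ ∪ (⁅ w₁ ⁆ ∪ ⁅ w₂ ⁆) ∣ ≡ 3
  size = trans
    (∣⁅x⁆∪p∣ w₀ _ ([ ∉⁅⁆ zero (suc zero) (λ ()) , ∉⁅⁆ zero (suc (suc zero)) (λ ()) ]′ ∘ x∈p∪q⁻ ⁅ w₁ ⁆ ⁅ w₂ ⁆))
    (cong suc (trans (∣⁅x⁆∪p∣ w₁ _ (∉⁅⁆ (suc zero) (suc (suc zero)) (λ ()))) (cong suc (∣⁅x⁆∣≡1 w₂))))

-- Boolean equality and simplicity of the line graph.

==-refl : ∀ {m} (a : Fin m) → T (a == a)
==-refl a = ℕ.≡⇒≡ᵇ (toℕ a) (toℕ a) refl

==⇒≡ : ∀ {m} (a b : Fin m) → T (a == b) → a ≡ b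
==⇒≡ a b t = toℕ-injective (ℕ.≡ᵇ⇒≡ (toℕ a) (toℕ b) t)

==-comm : ∀ {m} (a b : Fin m) → (a == b) ≡ (b == a)
==-comm a b = ≡ᵇ-comm (toℕ a) (toℕ b)
  where
  ≡ᵇ-comm : ∀ i j → (i ≡ᵇ j) ≡ (j ≡ᵇ i)
  ≡ᵇ-comm zero    zero    = refl
  ≡ᵇ-comm zero    (suc j) = refl
  ≡ᵇ-comm (suc i) zero    = refl
  ≡ᵇ-comm (suc i) (suc j) = ≡ᵇ-comm i j

≢⇒T-not-== : ∀ {m} {a b : Fin m} → a ≢ b → T (not (a == b))
≢⇒T-not-== {a = a} {b} a≢b with a == b in eq
... | false = _
... | true  = contradiction (==⇒≡ a b (subst T (sym eq) _)) a≢b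

shareEnd-comm : ∀ {m} (e f : Fin m × Fin m) → shareEnd e f ≡ shareEnd f e
shareEnd-comm (a , b) (c , d)
  rewrite ==-comm c a | ==-comm c b | ==-comm d a | ==-comm d b
  = cong ((a == c) ∨_) (swap (a == d) (b == c) (b == d))
  where
  swap : ∀ p q r → p ∨ q ∨ r ≡ q ∨ p ∨ r
  swap true  true  r = refl
  swap true  false r = refl
  swap false true  r = refl
  swap false false r = refl

-- This allows the inequality between ω₃ and π₃ to be applied a second time, to `L G` in place of
-- `G`.
L-simple : ∀ G → IsSimple (L G)
L-simple G =
  (λ k l → cong₂ (λ p q → not p ∧ q) (==-comm k l)
             (shareEnd-comm (lookup (edgeList G) k) (lookup (edgeList G) l))) ,
  irreflexive
  where
  irreflexive : ∀ k → adj (L G) k k ≡ false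
  irreflexive k with k == k | ==-refl k
  ... | true | _ = refl

-- The edge list of a graph.

module _ (G : Graph) where

  -- `edgesAt` and `edgesFrom` name the blocks into which `edgeList` unfolds, so that each
  -- `concatMap` can be treated separately.
  edgesAt : Fin (n G) → Fin (n G) → List (Fin (n G) × Fin (n G))
  edgesAt i j = if (toℕ i <ᵇ toℕ j) ∧ adj G i j then [ (i , j) ] else []

  ∈-edgesAt⁻ : ∀ {e} i j → e ∈ edgesAt i j → e ≡ (i , j) × toℕ i < toℕ j
  ∈-edgesAt⁻ i j e∈ with (toℕ i <ᵇ toℕ j) ∧ adj G i j in eq
  ∈-edgesAt⁻ i j (here e≡) | true =
    e≡ , ℕ.<ᵇ⇒< _ _ (proj₁ (Equivalence.to T-∧ (subst T (sym eq) _)))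

  ∈-edgesAt⁺ : ∀ {i j} → toℕ i < toℕ j → Adj G i j → (i , j) ∈ edgesAt i j
  ∈-edgesAt⁺ {i} {j} i<j i~j with (toℕ i <ᵇ toℕ j) ∧ adj G i j in eq
  ... | true  = here refl
  ... | false = ⊥-elim (subst T eq (Equivalence.from T-∧ (ℕ.<⇒<ᵇ i<j , i~j)))

  edgesFrom : Fin (n G) → List (Fin (n G) × Fin (n G))
  edgesFrom i = concatMap (edgesAt i) (allFin (n G))

  ∈-edgesFrom⁻ : ∀ {e} i → e ∈ edgesFrom i → proj₁ e ≡ i × toℕ (proj₁ e) < toℕ (proj₂ e)
  ∈-edgesFrom⁻ i e∈ with j , _ , e∈′ ← find (∈-concatMap⁻ (edgesAt i) {xs = allFin (n G)} e∈)
    with refl , i<j ← ∈-edgesAt⁻ i j e∈′ = refl , i<j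

  edgeList-< : ∀ {e} → e ∈ edgeList G → toℕ (proj₁ e) < toℕ (proj₂ e)
  edgeList-< e∈ with i , _ , e∈′ ← find (∈-concatMap⁻ edgesFrom {xs = allFin (n G)} e∈) = proj₂ (∈-edgesFrom⁻ i e∈′)

  edgeList-∋ : ∀ {i j} → toℕ i < toℕ j → Adj G i j → (i , j) ∈ edgeList G
  edgeList-∋ {i} {j} i<j i~j = ∈-concatMap⁺ edgesFrom (lose (∈-allFin i)
    (∈-concatMap⁺ (edgesAt i) (lose (∈-allFin j) (∈-edgesAt⁺ i<j i~j))))

  edgeList-unique : Unique (edgeList G)
  edgeList-unique = unique-concatMap edgesFrom
    (λ i → unique-concatMap (edgesAt i) (edgesAt-unique i)
      (λ e∈j e∈j′ → cong proj₂ (trans (sym (proj₁ (∈-edgesAt⁻ i _ e∈j))) (proj₁ (∈-edgesAt⁻ i _ e∈j′))))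
      (allFin⁺ (n G)))
    (λ e∈i e∈i′ → trans (sym (proj₁ (∈-edgesFrom⁻ _ e∈i))) (proj₁ (∈-edgesFrom⁻ _ e∈i′)))
    (allFin⁺ (n G))
    where
    edgesAt-unique : ∀ i j → Unique (edgesAt i j)
    edgesAt-unique i j with (toℕ i <ᵇ toℕ j) ∧ adj G i j
    ... | true  = All.[] ∷ []
    ... | false = []

-- Incidence of edges and vertices.

module LineGraph (G : Graph) (simple : IsSimple G) where

  V E : Set
  V = Fin (n G)
  E = Fin (n (L G))

  ends : E → V × V
  ends = lookup (edgeList G)

  Joins : E → V → V → Set
  Joins f x y = SameEdge (ends f) (x , y)

  Inc : E → V → Set
  Inc f x = x ≡ proj₁ (ends f) ⊎ x ≡ proj₂ (ends f)

  joins-sym : ∀ {f x y} → Joins f x y → Joins f y x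
  joins-sym (inj₁ p) = inj₂ p
  joins-sym (inj₂ p) = inj₁ p

  joins⇒inc₁ : ∀ {f x y} → Joins f x y → Inc f x
  joins⇒inc₁ (inj₁ (p , q)) = inj₁ (sym p)
  joins⇒inc₁ (inj₂ (p , q)) = inj₂ (sym q)

  joins⇒inc₂ : ∀ {f x y} → Joins f x y → Inc f y
  joins⇒inc₂ = joins⇒inc₁ ∘ joins-sym

  inc-joins : ∀ {f x y z} → Joins f x y → Inc f z → z ≡ x ⊎ z ≡ y
  inc-joins (inj₁ (refl , refl)) i = i
  inc-joins (inj₂ (refl , refl)) (inj₁ p) = inj₂ p
  inc-joins (inj₂ (refl , refl)) (inj₂ p) = inj₁ p

  ends-< : ∀ f → toℕ (proj₁ (ends f)) < toℕ (proj₂ (ends f))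
  ends-< f = edgeList-< G (∈-lookup f)

  joins⇒≢ : ∀ {f x y} → Joins f x y → x ≢ y
  joins⇒≢ {f} (inj₁ (refl , refl)) eq = ℕ.<⇒≢ (ends-< f) (cong toℕ eq)
  joins⇒≢ {f} (inj₂ (refl , refl)) eq = ℕ.<⇒≢ (ends-< f) (cong toℕ (sym eq))

  -- The entries of `edgeList` are distinct and carry the smaller end first, so two of them with the
  -- same ends cannot differ by a swap either.
  joins-unique : ∀ {f g x y} → Joins f x y → Joins g x y → f ≡ g
  joins-unique {f} {g} = λ where
      (inj₁ (p , q)) (inj₁ (p′ , q′)) → same (trans p (sym p′)) (trans q (sym q′))
      (inj₂ (p , q)) (inj₂ (p′ , q′)) → same (trans p (sym p′)) (trans q (sym q′))
      (inj₁ (p , q)) (inj₂ (p′ , q′)) → ⊥-elim (crossed (trans p (sym q′)) (trans q (sym p′)))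
      (inj₂ (p , q)) (inj₁ (p′ , q′)) → ⊥-elim (crossed (trans p (sym q′)) (trans q (sym p′)))
    where
    same : proj₁ (ends f) ≡ proj₁ (ends g) → proj₂ (ends f) ≡ proj₂ (ends g) → f ≡ g
    same p q = unique-lookup-injective (edgeList-unique G) f g (cong₂ _,_ p q)
    crossed : proj₁ (ends f) ≡ proj₂ (ends g) → proj₂ (ends f) ≡ proj₁ (ends g) → ⊥
    crossed p q = ℕ.<-asym (ends-< f)
      (subst (λ (a , b) → toℕ a < toℕ b) (sym (cong₂ _,_ q p)) (ends-< g))

  edge : ∀ {x y} → Adj G x y → ∃ λ f → Joins f x y
  edge {x} {y} x~y with ℕ.<-cmp (toℕ x) (toℕ y)
  ... | tri< x<y _ _ = index x∈ , inj₁ (cong proj₁ eq , cong proj₂ eq)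
    where
    x∈ = edgeList-∋ G x<y x~y
    eq = sym (lookup-index x∈)
  ... | tri> _ _ y<x = index x∈ , inj₂ (cong proj₁ eq , cong proj₂ eq)
    where
    x∈ = edgeList-∋ G y<x (subst T (proj₁ simple x y) x~y)
    eq = sym (lookup-index x∈)
  ... | tri≈ _ x≡y _ with refl ← toℕ-injective x≡y = ⊥-elim (subst T (proj₂ simple x) x~y)

  adjacent : ∀ {f g x} → f ≢ g → Inc f x → Inc g x → Adj (L G) f g
  adjacent {f} {g} {x} f≢g = λ i j → Equivalence.from T-∧ (≢⇒T-not-== f≢g , shared i j)
    where
    a = proj₁ (ends f)
    b = proj₂ (ends f)
    c = proj₁ (ends g)
    d = proj₂ (ends g)
    or : ∀ {p q} → T p ⊎ T q → T (p ∨ q)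
    or = Equivalence.from T-∨
    eq : ∀ {u v : V} → x ≡ u → x ≡ v → T (u == v)
    eq refl refl = ==-refl x
    shared : Inc f x → Inc g x → T (shareEnd (ends f) (ends g))
    shared (inj₁ p) (inj₁ q) = or {a == c} (inj₁ (eq p q))
    shared (inj₁ p) (inj₂ q) = or {a == c} (inj₂ (or {a == d} (inj₁ (eq p q))))
    shared (inj₂ p) (inj₁ q) = or {a == c} (inj₂ (or {a == d} (inj₂ (or {b == c} (inj₁ (eq p q))))))
    shared (inj₂ p) (inj₂ q) = or {a == c} (inj₂ (or {a == d} (inj₂ (or {b == c} (inj₂ (eq p q))))))

  -- If both ends of `f` were on `g`, the two edges would be parallel and hence equal.
  private-end : ∀ {f g} → f ≢ g → ∃ λ x → Inc f x × ¬ Inc g x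
  private-end {f} {g} f≢g with inc? g (proj₁ (ends f)) | inc? g (proj₂ (ends f))
    where
    inc? : ∀ g x → Dec (Inc g x)
    inc? g x = (x ≟ proj₁ (ends g)) ⊎-dec (x ≟ proj₂ (ends g))
  ... | no ∉₁ | _     = _ , inj₁ refl , ∉₁
  ... | yes _ | no ∉₂ = _ , inj₂ refl , ∉₂
  ... | yes i | yes j = contradiction
    (joins-unique (inj₁ (refl , refl)) (joins (joins⇒≢ {f} (inj₁ (refl , refl))) i j)) f≢g
    where
    joins : ∀ {x y} → x ≢ y → Inc g x → Inc g y → Joins g x y
    joins x≢y (inj₁ p) (inj₁ q) = contradiction (trans p (sym q)) x≢y
    joins x≢y (inj₁ p) (inj₂ q) = inj₁ (sym p , sym q)
    joins x≢y (inj₂ p) (inj₁ q) = inj₂ (sym q , sym p)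
    joins x≢y (inj₂ p) (inj₂ q) = contradiction (trans p (sym q)) x≢y

  -- Edges traversed by a vertex sequence, and shortcuts.

  infix 4 _∈ᵉ_

  _∈ᵉ_ : E → List V → Set
  f ∈ᵉ xs = ∃₂ λ x y → (x , y) ∈ consecPairs xs × Joins f x y

  ∈ᵉ-inc : ∀ {f x xs} → f ∈ᵉ xs → Inc f x → x ∈ xs
  ∈ᵉ-inc {xs = xs} (_ , _ , c , j) i with inc-joins j i
  ... | inj₁ refl = consec⇒∈₁ xs c
  ... | inj₂ refl = consec⇒∈₂ xs c

  ∈ᵉ-∷ : ∀ {f x xs} → f ∈ᵉ xs → f ∈ᵉ x ∷ xs
  ∈ᵉ-∷ {xs = xs} (x , y , c , j) = x , y , consec-∷ xs c , j

  ∈ᵉ-++⁺ˡ : ∀ {f xs ys} → f ∈ᵉ xs → f ∈ᵉ xs ++ ys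
  ∈ᵉ-++⁺ˡ {xs = xs} (x , y , c , j) = x , y , consec-++⁺ˡ xs c , j

  ∈ᵉ-++⁺ʳ : ∀ {f} xs {ys} → f ∈ᵉ ys → f ∈ᵉ xs ++ ys
  ∈ᵉ-++⁺ʳ xs (x , y , c , j) = x , y , consec-++⁺ʳ xs c , j

  ∈ᵉ-disjoint : ∀ {f} (P Q : Path G) → EdgeDisjoint P Q → f ∈ᵉ verts P → f ∈ᵉ verts Q → ⊥
  ∈ᵉ-disjoint P Q disj (x , y , c , j) (x′ , y′ , c′ , j′) = disj (x , y) (x′ , y′) c c′ (joins-same j j′)
    where
    joins-same : ∀ {f x y x′ y′} → Joins f x y → Joins f x′ y′ → SameEdge (x , y) (x′ , y′)
    joins-same (inj₁ (refl , refl)) j = j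
    joins-same (inj₂ (refl , refl)) (inj₁ (p , q)) = inj₂ (q , p)
    joins-same (inj₂ (refl , refl)) (inj₂ (p , q)) = inj₁ (q , p)

  -- What holds when a route along xs from e at x to e′ at y has no inner edges; two edge-disjoint
  -- walks cannot both admit it (shortcut-disjoint).
  Shortcut : List V → V → V → E → E → Set
  Shortcut xs x y e e′ =
    (e ∈ᵉ xs × e′ ∈ᵉ xs) ⊎ (e ∈ᵉ xs × Joins e x y) ⊎ (e′ ∈ᵉ xs × Joins e′ x y)

  shortcut-map : ∀ {xs ys x y e e′} → (∀ {f} → f ∈ᵉ xs → f ∈ᵉ ys) →
                 Shortcut xs x y e e′ → Shortcut ys x y e e′
  shortcut-map ⊆ (inj₁ (p , q))        = inj₁ (⊆ p , ⊆ q)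
  shortcut-map ⊆ (inj₂ (inj₁ (p , j))) = inj₂ (inj₁ (⊆ p , j))
  shortcut-map ⊆ (inj₂ (inj₂ (p , j))) = inj₂ (inj₂ (⊆ p , j))

  shortcut-sym : ∀ {xs x y e e′} → Shortcut xs x y e e′ → Shortcut xs y x e′ e
  shortcut-sym (inj₁ (p , q))                = inj₁ (q , p)
  shortcut-sym {e = e} (inj₂ (inj₁ (p , j))) = inj₂ (inj₂ (p , joins-sym {e} j))
  shortcut-sym {e′ = e′} (inj₂ (inj₂ (p , j))) = inj₂ (inj₁ (p , joins-sym {e′} j))

  -- Every combination of cases gives an edge traversed by both lists, except when one uses `e` and
  -- the other `e′` as a direct edge from `x` to `y`; then `e` and `e′` are parallel.
  shortcut-disjoint : ∀ {xs ys x y e e′} → (∀ {f} → f ∈ᵉ xs → f ∈ᵉ ys → ⊥) → e ≢ e′ →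
                      Shortcut xs x y e e′ → ¬ Shortcut ys x y e e′
  shortcut-disjoint disj e≢e′ = λ where
    (inj₁ (p , q))        (inj₁ (p′ , _))         → disj p p′
    (inj₁ (p , q))        (inj₂ (inj₁ (p′ , _)))  → disj p p′
    (inj₁ (p , q))        (inj₂ (inj₂ (q′ , _)))  → disj q q′
    (inj₂ (inj₁ (p , _))) (inj₁ (p′ , _))         → disj p p′
    (inj₂ (inj₂ (q , _))) (inj₁ (_ , q′))         → disj q q′
    (inj₂ (inj₁ (p , _))) (inj₂ (inj₁ (p′ , _)))  → disj p p′
    (inj₂ (inj₂ (q , _))) (inj₂ (inj₂ (q′ , _)))  → disj q q′
    (inj₂ (inj₁ (_ , j))) (inj₂ (inj₂ (_ , j′)))  → e≢e′ (joins-unique j j′)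
    (inj₂ (inj₂ (_ , j))) (inj₂ (inj₁ (_ , j′)))  → e≢e′ (joins-unique j′ j)

  -- Turning a path between two vertices into a path between two edges.

  record Route (xs : List V) (x y : V) (e e′ : E) : Set where
    field
      inner    : List E
      linked   : Linked (Adj (L G)) (e ∷ inner ++ [ e′ ])
      unique   : Unique inner
      e∉       : e ∉ inner
      e′∉      : e′ ∉ inner
      inner⊆   : ∀ {f} → f ∈ inner → f ∈ᵉ xs
      shortcut : inner ≡ [] → Shortcut xs x y e e′

  -- Induction along the path, reading off its edges. A first edge equal to `e`, or a last edge
  -- equal to `e′`, is left out, since that edge already stands at the end of the route.
  route : ∀ {x y e e′} q → Linked (Adj G) (x ∷ q ++ [ y ]) → Unique (x ∷ q ++ [ y ]) →
          Inc e x → Inc e′ y → e ≢ e′ → Route (x ∷ q ++ [ y ]) x y e e′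
  route {x} {y} {e} {e′} [] (x~y ∷ _) u ex e′y e≢e′ with f , j ← edge x~y with e ≟ f | e′ ≟ f
  ... | yes refl | _ = record
    { inner = [] ; linked = adjacent e≢e′ (joins⇒inc₂ {f} j) e′y ∷ [-] ; unique = []
    ; e∉ = λ () ; e′∉ = λ () ; inner⊆ = λ ()
    ; shortcut = λ _ → inj₂ (inj₁ ((x , y , here refl , j) , j)) }
  ... | no _ | yes refl = record
    { inner = [] ; linked = adjacent e≢e′ ex (joins⇒inc₁ {f} j) ∷ [-] ; unique = []
    ; e∉ = λ () ; e′∉ = λ () ; inner⊆ = λ ()
    ; shortcut = λ _ → inj₂ (inj₂ ((x , y , here refl , j) , j)) }
  ... | no e≢f | no e′≢f = record
    { inner = [ f ]
    ; linked = adjacent e≢f ex (joins⇒inc₁ {f} j) ∷ adjacent (≢-sym e′≢f) (joins⇒inc₂ {f} j) e′y ∷ [-]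
    ; unique = All.[] ∷ []
    ; e∉ = λ { (here p) → e≢f p } ; e′∉ = λ { (here p) → e′≢f p }
    ; inner⊆ = λ { (here refl) → x , y , here refl , j }
    ; shortcut = λ () }
  route {x} {y} {e} {e′} (x₁ ∷ q) (x~x₁ ∷ l) u@(_ ∷ u′) ex e′y e≢e′
    with f , j ← edge x~x₁ with e ≟ f | e′ ≟ f
  ... | yes refl | _ = record
    { Route rest
    ; inner⊆ = ∈ᵉ-∷ ∘ Route.inner⊆ rest
    ; shortcut = shortcut′ ∘ Route.shortcut rest }
    where
    rest = route q l u′ (joins⇒inc₂ {f} j) e′y e≢e′
    -- The rest of the path cannot traverse `e`, as it would return to `x`. So it traverses `e′`,
    -- and together with the first edge `e` both are traversed.
    shortcut′ : Shortcut (x₁ ∷ q ++ [ y ]) x₁ y e e′ → Shortcut (x ∷ x₁ ∷ q ++ [ y ]) x y e e′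
    shortcut′ (inj₁ (e∈ , _))         = ⊥-elim (Unique[x∷xs]⇒x∉xs u (∈ᵉ-inc {f} e∈ ex))
    shortcut′ (inj₂ (inj₁ (e∈ , _)))  = ⊥-elim (Unique[x∷xs]⇒x∉xs u (∈ᵉ-inc {f} e∈ ex))
    shortcut′ (inj₂ (inj₂ (e′∈ , _))) = inj₁ ((x , x₁ , here refl , j) , ∈ᵉ-∷ {e′} e′∈)
  -- Here `y` would be an end of the first edge, although it comes later on the path.
  ... | no _ | yes refl = ⊥-elim (case inc-joins {f} j e′y of λ where
    (inj₁ refl) → Unique[x∷xs]⇒x∉xs u (∈-++⁺ʳ (x₁ ∷ q) (here refl))
    (inj₂ refl) → Unique[x∷xs]⇒x∉xs u′ (∈-++⁺ʳ q (here refl)))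
  -- The rest is routed from `f` instead of `e`, so `Route.e∉ rest` says that `f` does not recur;
  -- `e` itself cannot occur there because its end `x` is not revisited.
  ... | no e≢f | no e′≢f = record
    { inner = f ∷ Route.inner rest
    ; linked = adjacent e≢f ex (joins⇒inc₁ {f} j) ∷ Route.linked rest
    ; unique = unique-∷ (Route.e∉ rest) (Route.unique rest)
    ; e∉ = λ { (here p) → e≢f p
             ; (there e∈) → Unique[x∷xs]⇒x∉xs u (∈ᵉ-inc {e} (Route.inner⊆ rest e∈) ex) }
    ; e′∉ = λ { (here p) → e′≢f p ; (there e′∈) → Route.e′∉ rest e′∈ }
    ; inner⊆ = λ { (here refl) → x , x₁ , here refl , j ; (there g∈) → ∈ᵉ-∷ (Route.inner⊆ rest g∈) }
    ; shortcut = λ () }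
    where rest = route q l u′ (joins⇒inc₂ {f} j) e′y (≢-sym e′≢f)

  -- Lifting paths through three vertices to the line graph.

  module Lift (k : Fin 3 → E) (k-inj : ∀ {i j} → k i ≡ k j → i ≡ j)
              (w : Fin 3 → V) (w-inj : ∀ {i j} → w i ≡ w j → i ≡ j)
              (inc : ∀ i → Inc (k i) (w i)) where

    Short : List V → Fin 3 → Fin 3 → Set
    Short xs i j = Shortcut xs (w i) (w j) (k i) (k j)

    -- `path⊆` controls the common vertices of two lifts; `consec` controls the only edges that they
    -- could then share, those between two of the `k i`.
    record Lifted (xs : List V) : Set where
      field
        path   : Path (L G)
        k∈     : ∀ i → k i ∈ verts path
        path⊆  : ∀ {f} → f ∈ verts path → (∃ λ i → f ≡ k i) ⊎ f ∈ᵉ xs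
        consec : ∀ i j → (k i , k j) ∈ consecPairs (verts path) → i ≢ j × Short xs i j

    -- The routes of the two segments are glued at `k b`. The segments share only the vertex `w b`,
    -- hence no edge, so the result has no repetition.
    liftWalk : ∀ {a b c q r} → Distinct₃ a b c →
               let M = w a ∷ q ++ w b ∷ r ++ [ w c ] in
               Linked (Adj G) M → Unique M → Lifted M
    liftWalk {a} {b} {c} {q} {r} dist@(a≢b , b≢c , a≢c) lM uM = record
      { path = mkPath Q uQ (linked-glue (k a ∷ I) R₁.linked R₂.linked)
      ; k∈ = λ i → k∈Q i (distinct₃-covers a b c dist i)
      ; path⊆ = Q⊆
      ; consec = λ i j m → case consec-++⁻ (k a ∷ I) m of λ where
          (inj₁ m₁) → first  i j (consec-ends I m₁)
          (inj₂ m₂) → second i j (consec-ends J m₂) }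
      where
      M seg₁ seg₂ : List V
      M    = w a ∷ q ++ w b ∷ r ++ [ w c ]
      seg₁ = w a ∷ q ++ [ w b ]
      seg₂ = w b ∷ r ++ [ w c ]

      -- `M` ends in `seg₂` by definition; rebracketing exhibits `seg₁` as a prefix.
      M≡ : M ≡ seg₁ ++ r ++ [ w c ]
      M≡ = cong (w a ∷_) (sym (++-assoc q [ w b ] (r ++ [ w c ])))

      route₁ : Route seg₁ (w a) (w b) (k a) (k b)
      route₁ = route q (linked-++⁻ˡ seg₁ (subst (Linked _) M≡ lM))
                       (unique-++⁻ˡ seg₁ (subst Unique M≡ uM))
                       (inc a) (inc b) (a≢b ∘ k-inj)

      route₂ : Route seg₂ (w b) (w c) (k b) (k c)
      route₂ = route r (linked-++⁻ʳ (w a ∷ q) lM) (unique-++⁻ʳ (w a ∷ q) uM)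
                       (inc b) (inc c) (b≢c ∘ k-inj)

      module R₁ = Route route₁
      module R₂ = Route route₂

      I J Q : List E
      I = R₁.inner
      J = R₂.inner
      Q = (k a ∷ I) ++ k b ∷ J ++ [ k c ]

      seg₁⊆ : ∀ {f} → f ∈ᵉ seg₁ → f ∈ᵉ M
      seg₁⊆ {f} f∈ = subst (f ∈ᵉ_) (sym M≡) (∈ᵉ-++⁺ˡ f∈)

      seg₂⊆ : ∀ {f} → f ∈ᵉ seg₂ → f ∈ᵉ M
      seg₂⊆ = ∈ᵉ-++⁺ʳ (w a ∷ q)

      meet : ∀ {z} → z ∈ seg₁ → z ∈ seg₂ → z ≡ w b
      meet z∈₁ z∈₂ with ∈-++⁻ (w a ∷ q) z∈₁
      ... | inj₁ z∈         = contradiction z∈₂ (unique-++-disjoint (w a ∷ q) uM z∈)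
      ... | inj₂ (here z≡)  = z≡

      -- By `meet`, both ends of a common edge would be `w b`.
      edges-disjoint : ∀ {f} → f ∈ᵉ seg₁ → f ∈ᵉ seg₂ → ⊥
      edges-disjoint {f} f∈₁@(_ , _ , _ , j) f∈₂ = joins⇒≢ {f} j
        (trans (meet (∈ᵉ-inc f∈₁ (joins⇒inc₁ {f} j)) (∈ᵉ-inc f∈₂ (joins⇒inc₁ {f} j)))
          (sym (meet (∈ᵉ-inc f∈₁ (joins⇒inc₂ {f} j)) (∈ᵉ-inc f∈₂ (joins⇒inc₂ {f} j)))))

      -- Otherwise `w c`, being an end of `k c`, would lie on both segments and equal `w b`.
      kc∉I : k c ∉ I
      kc∉I c∈ = b≢c (sym (w-inj (meet (∈ᵉ-inc (R₁.inner⊆ c∈) (inc c)) (∈-++⁺ʳ (w b ∷ r) (here refl)))))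

      ka∉J : k a ∉ J
      ka∉J a∈ = a≢b (w-inj (meet (here refl) (∈ᵉ-inc (R₂.inner⊆ a∈) (inc a))))

      k∉I : ∀ i → k i ∉ I
      k∉I i with distinct₃-covers a b c dist i
      ... | inj₁ refl        = R₁.e∉
      ... | inj₂ (inj₁ refl) = R₁.e′∉
      ... | inj₂ (inj₂ refl) = kc∉I

      k∉J : ∀ i → k i ∉ J
      k∉J i with distinct₃-covers a b c dist i
      ... | inj₁ refl        = ka∉J
      ... | inj₂ (inj₁ refl) = R₂.e∉
      ... | inj₂ (inj₂ refl) = R₂.e′∉

      k≢ : ∀ {i j} → i ≢ j → k i ≢ k j
      k≢ i≢j = i≢j ∘ k-inj

      tail⁻ : ∀ {f} → f ∈ k b ∷ J ++ [ k c ] → f ≡ k b ⊎ f ≡ k c ⊎ f ∈ J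
      tail⁻ (here p) = inj₁ p
      tail⁻ (there f∈) with ∈-++⁻ J f∈
      ... | inj₁ f∈J      = inj₂ (inj₂ f∈J)
      ... | inj₂ (here p) = inj₂ (inj₁ p)

      uQ : Unique Q
      uQ = ++⁺ (unique-∷ (k∉I a) R₁.unique)
               (unique-∷ b∉ (++⁺ R₂.unique (All.[] ∷ []) λ { (f∈J , here refl) → k∉J c f∈J }))
               λ (f∈₁ , f∈₂) → disjoint f∈₁ (tail⁻ f∈₂)
        where
        b∉ : k b ∉ J ++ [ k c ]
        b∉ b∈ with ∈-++⁻ J b∈
        ... | inj₁ b∈J      = k∉J b b∈J
        ... | inj₂ (here p) = k≢ b≢c p
        disjoint : ∀ {f} → f ∈ k a ∷ I → f ≡ k b ⊎ f ≡ k c ⊎ f ∈ J → ⊥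
        disjoint (here refl) (inj₁ p)           = k≢ a≢b p
        disjoint (here refl) (inj₂ (inj₁ p))    = k≢ a≢c p
        disjoint (here refl) (inj₂ (inj₂ a∈J))  = k∉J a a∈J
        disjoint (there f∈I) (inj₁ refl)        = k∉I b f∈I
        disjoint (there f∈I) (inj₂ (inj₁ refl)) = k∉I c f∈I
        disjoint (there f∈I) (inj₂ (inj₂ f∈J))  = edges-disjoint (R₁.inner⊆ f∈I) (R₂.inner⊆ f∈J)

      k∈Q : ∀ i → i ≡ a ⊎ i ≡ b ⊎ i ≡ c → k i ∈ Q
      k∈Q i (inj₁ refl)        = here refl
      k∈Q i (inj₂ (inj₁ refl)) = ∈-++⁺ʳ (k a ∷ I) (here refl)
      k∈Q i (inj₂ (inj₂ refl)) = ∈-++⁺ʳ (k a ∷ I) (∈-++⁺ʳ (k b ∷ J) (here refl))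

      Q⊆ : ∀ {f} → f ∈ Q → (∃ λ i → f ≡ k i) ⊎ f ∈ᵉ M
      Q⊆ f∈ with ∈-++⁻ (k a ∷ I) f∈
      ... | inj₁ (here p)    = inj₁ (a , p)
      ... | inj₁ (there f∈I) = inj₂ (seg₁⊆ (R₁.inner⊆ f∈I))
      ... | inj₂ f∈₂ with tail⁻ f∈₂
      ...   | inj₁ p          = inj₁ (b , p)
      ...   | inj₂ (inj₁ p)   = inj₁ (c , p)
      ...   | inj₂ (inj₂ f∈J) = inj₂ (seg₂⊆ (R₂.inner⊆ f∈J))

      -- By `k∉I` only the case of an empty inner part survives, and there the shortcut of the first
      -- route applies.
      first : ∀ i j → (k i ∈ I ⊎ k j ∈ I) ⊎ (I ≡ [] × k i ≡ k a × k j ≡ k b) → i ≢ j × Short M i j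
      first i j (inj₁ (inj₁ i∈)) = contradiction i∈ (k∉I i)
      first i j (inj₁ (inj₂ j∈)) = contradiction j∈ (k∉I j)
      first i j (inj₂ (I≡ , p , q)) with refl ← k-inj p | refl ← k-inj q =
        a≢b , shortcut-map seg₁⊆ (R₁.shortcut I≡)

      second : ∀ i j → (k i ∈ J ⊎ k j ∈ J) ⊎ (J ≡ [] × k i ≡ k b × k j ≡ k c) → i ≢ j × Short M i j
      second i j (inj₁ (inj₁ i∈)) = contradiction i∈ (k∉J i)
      second i j (inj₁ (inj₂ j∈)) = contradiction j∈ (k∉J j)
      second i j (inj₂ (J≡ , p , q)) with refl ← k-inj p | refl ← k-inj q =
        b≢c , shortcut-map seg₂⊆ (R₂.shortcut J≡)

    lifted-mono : ∀ {xs ys} → (∀ {f} → f ∈ᵉ xs → f ∈ᵉ ys) → Lifted xs → Lifted ys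
    lifted-mono ⊆ ℓ = record
      { path = path ; k∈ = k∈
      ; path⊆ = λ f∈ → case path⊆ f∈ of λ where
          (inj₁ i)   → inj₁ i
          (inj₂ f∈ᵉ) → inj₂ (⊆ f∈ᵉ)
      ; consec = λ i j m → let i≢j , short = consec i j m in i≢j , shortcut-map ⊆ short }
      where open Lifted ℓ

    liftPath : (P : Path G) → (∀ i → w i ∈ verts P) → Lifted (verts P)
    liftPath P w∈ = lifted-mono M⊆ (liftWalk distinct
        (linked-++⁻ˡ M (linked-++⁻ʳ p (subst (Linked _) split′ (linked P))))
        (unique-++⁻ˡ M (unique-++⁻ʳ p (subst Unique split′ (unique P)))))
      where
      open Ordered₃ (order₃ w-inj w∈)
      M = w a ∷ q ++ w b ∷ r ++ [ w c ]
      split′ : verts P ≡ p ++ M ++ s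
      split′ = trans split (cong (λ t → p ++ w a ∷ t)
        (trans (cong (λ t → q ++ w b ∷ t) (sym (++-assoc r [ w c ] s)))
               (sym (++-assoc q (w b ∷ r ++ [ w c ]) s))))
      M⊆ : ∀ {f} → f ∈ᵉ M → f ∈ᵉ verts P
      M⊆ {f} f∈ = subst (f ∈ᵉ_) (sym split′) (∈ᵉ-++⁺ʳ p (∈ᵉ-++⁺ˡ f∈))

    -- A common vertex of the lifts that is none of the `k i` would be an edge traversed by both `P`
    -- and `P′`.
    lift-disjoint : ∀ (P P′ : Path G) → EdgeDisjoint P P′ →
                    (ℓ : Lifted (verts P)) (ℓ′ : Lifted (verts P′)) →
                    ∀ {S} → (∀ i → k i ∈ₛ S) → (∀ f → f ∈ₛ S → ∃ λ i → f ≡ k i) →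
                    InternallyDisjoint S (Lifted.path ℓ) (Lifted.path ℓ′)
    lift-disjoint P P′ disj ℓ ℓ′ {S} k∈S onto = edge-disjoint , λ f → common
      where
      module ℓ = Lifted ℓ
      module ℓ′ = Lifted ℓ′

      common : ∀ {f} → f ∈ verts ℓ.path → f ∈ verts ℓ′.path → f ∈ₛ S
      common f∈ f∈′ with ℓ.path⊆ f∈ | ℓ′.path⊆ f∈′
      ... | inj₁ (i , refl) | _               = k∈S i
      ... | _               | inj₁ (i , refl) = k∈S i
      ... | inj₂ f∈P        | inj₂ f∈P′       = ⊥-elim (∈ᵉ-disjoint P P′ disj f∈P f∈P′)

      -- Both paths of `G` would admit a shortcut between the same two ends; the second one is
      -- reversed when its lift runs along the edge in the opposite direction.
      no-common-edge : ∀ i j → (k i , k j) ∈ consecPairs (verts ℓ.path) →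
                       (k i , k j) ∈ consecPairs (verts ℓ′.path) ⊎
                       (k j , k i) ∈ consecPairs (verts ℓ′.path) → ⊥
      no-common-edge i j m m′ with i≢j , short ← ℓ.consec i j m =
        shortcut-disjoint (∈ᵉ-disjoint P P′ disj) (i≢j ∘ k-inj) short
          ([ proj₂ ∘ ℓ′.consec i j , shortcut-sym ∘ proj₂ ∘ ℓ′.consec j i ]′ m′)

      oriented : ∀ {f g} e′ → e′ ∈ consecPairs (verts ℓ′.path) → SameEdge (f , g) e′ →
                 f ∈ verts ℓ′.path × g ∈ verts ℓ′.path ×
                 ((f , g) ∈ consecPairs (verts ℓ′.path) ⊎ (g , f) ∈ consecPairs (verts ℓ′.path))
      oriented _ m′ (inj₁ (refl , refl)) = consec⇒∈₁ _ m′ , consec⇒∈₂ _ m′ , inj₁ m′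
      oriented _ m′ (inj₂ (refl , refl)) = consec⇒∈₂ _ m′ , consec⇒∈₁ _ m′ , inj₂ m′

      -- A common edge of the two lifts has both ends in S.
      edge-disjoint : EdgeDisjoint ℓ.path ℓ′.path
      edge-disjoint (f , g) e′ m m′ same
        with f∈′ , g∈′ , m″ ← oriented e′ m′ same
        with i , refl ← onto f (common (consec⇒∈₁ _ m) f∈′)
           | j , refl ← onto g (common (consec⇒∈₂ _ m) g∈′)
        = no-common-edge i j m m″

  -- Distinct ends for three edges, and the inequality for ω₃ and π₃.

  private
    next : Fin 3 → Fin 3
    next zero             = suc zero
    next (suc zero)       = suc (suc zero)
    next (suc (suc zero)) = zero

  -- Choosing on k i an end that is not on k (next i) makes the three ends distinct.
  representatives : (k : Fin 3 → E) → (∀ {i j} → k i ≡ k j → i ≡ j) →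
                    Σ (Fin 3 → V) λ w → (∀ {i j} → w i ≡ w j → i ≡ j) × (∀ i → Inc (k i) (w i))
  representatives k k-inj = w , (λ {i} {j} → w-inj i j) , inc
    where
    end : ∀ i → ∃ λ x → Inc (k i) x × ¬ Inc (k (next i)) x
    end i = private-end λ eq → next≢ i (k-inj eq)
      where
      next≢ : ∀ i → i ≢ next i
      next≢ zero             ()
      next≢ (suc zero)       ()
      next≢ (suc (suc zero)) ()
    w : Fin 3 → V
    w i = proj₁ (end i)
    inc : ∀ i → Inc (k i) (w i)
    inc i = proj₁ (proj₂ (end i))
    w≢ : ∀ i → w i ≢ w (next i)
    w≢ i eq = proj₂ (proj₂ (end i)) (subst (Inc (k (next i))) (sym eq) (inc (next i)))
    -- Any two different indices are neighbours in the cyclic order given by `next`, so `w≢` applies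
    -- in one direction or the other.
    w-inj : ∀ i j → w i ≡ w j → i ≡ j
    w-inj zero             zero             eq = refl
    w-inj zero             (suc zero)       eq = contradiction eq (w≢ zero)
    w-inj zero             (suc (suc zero)) eq = contradiction (sym eq) (w≢ (suc (suc zero)))
    w-inj (suc zero)       zero             eq = contradiction (sym eq) (w≢ zero)
    w-inj (suc zero)       (suc zero)       eq = refl
    w-inj (suc zero)       (suc (suc zero)) eq = contradiction eq (w≢ (suc zero))
    w-inj (suc (suc zero)) zero             eq = contradiction eq (w≢ (suc (suc zero)))
    w-inj (suc (suc zero)) (suc zero)       eq = contradiction (sym eq) (w≢ (suc zero))
    w-inj (suc (suc zero)) (suc (suc zero)) eq = refl

  ω₃≤π₃L : ∀ m → ωₖAtLeast 3 G m → πₖAtLeast 3 (L G) m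
  ω₃≤π₃L m ω S ∣S∣≡3
    -- Transport along `∣S∣≡3` turns the index type `Fin ∣ S ∣` into `Fin 3`.
    with k , k-inj , k∈S , onto ← subst (λ s → Σ (Fin s → E) λ k →
           (∀ {i j} → k i ≡ k j → i ≡ j) × (∀ i → k i ∈ₛ S) × (∀ v → v ∈ₛ S → ∃ λ i → v ≡ k i))
           ∣S∣≡3 (enumerate S)
    with w , w-inj , inc ← representatives k k-inj
    with S′ , ∣S′∣≡3 , w∈ ← triple w w-inj
    with ps , spath , disj ← ω S′ ∣S′∣≡3
    = (λ i → Lifted.path (lifted i)) ,
      (λ i f f∈ → case onto f f∈ of λ { (j , refl) → Lifted.k∈ (lifted i) j }) ,
      λ i j i≢j → lift-disjoint (ps i) (ps j) (disj i j i≢j) (lifted i) (lifted j) k∈S onto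
    where
    open Lift k k-inj w w-inj inc
    lifted : ∀ i → Lifted (verts (ps i))
    lifted i = liftPath (ps i) (λ j → spath i (w j) (w∈ j))

-- Conclusion: the three inequalities.

πₖ⇒ωₖ : ∀ {k m} G → πₖAtLeast k G m → ωₖAtLeast k G m
πₖ⇒ωₖ G π S ∣S∣ with ps , spath , disj ← π S ∣S∣ = ps , spath , λ i j i≢j → proj₁ (disj i j i≢j)

-- Forgets the last path; for `m = 0` the family is empty and `m ∸ 1` is still `0`.
pairwise-pred : ∀ {G S m} (R : Path G → Path G → Set) →
                PairwiseSPaths S R m → PairwiseSPaths S R (m ∸ 1)
pairwise-pred {m = m} _ (ps , spath , disj) =
  ps ∘ weaken , spath ∘ weaken ,
  λ i j i≢j → disj (weaken i) (weaken j) (i≢j ∘ inject≤-injective (ℕ.m∸n≤m m 1) (ℕ.m∸n≤m m 1) i j)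
  where
  weaken : Fin (m ∸ 1) → Fin m
  weaken i = inject≤ i (ℕ.m∸n≤m m 1)

theorem2p4 : (G : Graph) → IsSimple G → TwoConnected G →
    ((m : ℕ) → ωₖAtLeast 3 G m → πₖAtLeast 3 (L G) m)
    × ((m : ℕ) → ωₖAtLeast 3 G m → ωₖAtLeast 3 (L G) (m ∸ 1))
    × ((m : ℕ) → πₖAtLeast 3 G m → πₖAtLeast 3 (L (L G)) (m ∸ 1))
theorem2p4 G simple _ =
  ω₃≤π₃L ,
  (λ m ω S ∣S∣ → pairwise-pred EdgeDisjoint (πₖ⇒ωₖ (L G) (ω₃≤π₃L m ω) S ∣S∣)) ,
  -- The first inequality is used for `G` and again for `L G`, each time after passing from
  -- internally disjoint to edge-disjoint paths.
  λ m π S ∣S∣ → pairwise-pred (InternallyDisjoint S) (L.ω₃≤π₃L m (πₖ⇒ωₖ (L G) (ω₃≤π₃L m (πₖ⇒ωₖ G π))) S ∣S∣)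
  where
  open LineGraph G simple
  module L = LineGraph (L G) (L-simple G)
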